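{- Let $f,g:\{0,1\}^n\to\{0,1\}$ be Boolean functions. If $f$ is PN-equivalent to $g$, then for any $K$ the graphs ${}^K\!SG(f)$ and ${}^K\!SG(g)$ are isomorphic. Similarly, ${}^K\!SG^0(f)$ and ${}^K\!SG^0(g)$ are isomorphic, and ${}^K\!SG^1(f)$ and ${}^K\!SG^1(g)$ are isomorphic.
   Context: For a word $x=(x_1,\dots,x_n)\in\{0,1\}^n$ and an index $i$, $x^i$ denotes the word obtained from $x$ by changing (flipping) its $i$-th bit. The (local) sensitivity of $f$ on $x$ is $s(f,x)=|\{i\in\{1,\dots,n\}: f(x)\neq f(x^i)\}|$. $K$ denotes a nonnegative integer. $Q_n$ is the $n$-dimensional hypercube graph: its vertices are the words in $\{0,1\}^n$, and two words are adjacent if and only if they differ in exactly one bit. The $K$-sensitivity graph ${}^K\!SG(f)$ is the induced subgraph of $Q_n$ on the vertex set $\{x\in\{0,1\}^n: s(f,x)=K\}$. The $K$-0-sensitivity graph ${}^K\!SG^0(f)$ and the $K$-1-sensitivity graph ${}^K\!SG^1(f)$ are the induced subgraphs of $Q_n$ on $\{x: s(f,x)=K, f(x)=0\}$ and $\{x: s(f,x)=K, f(x)=1\}$, respectively. PN-equivalence: $f$ is PN-equivalent to $g$ if there exist a permutation $\pi$ of the $n$ coordinates (acting on words by permuting their bits) and, for each coordinate $j$, a choice of whether or not to negate it (written $(\neg)x_j$, the choice being independent of $x$), such that $f(\pi((\neg)x_1,(\neg)x_2,\dots,(\neg)x_n))=g(x_1,\dots,x_n)$ for all $x\in\{0,1\}^n$.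 -}

module Defs where

open import Data.Bool using (Bool; true; false; not; _xor_; _≟_)
open import Data.Fin using (Fin)
open import Data.Fin.Permutation using (Permutation′; _⟨$⟩ʳ_)
open import Data.Fin.Subset using (Subset)
open import Data.Nat using (ℕ)
open import Data.Product using (_×_; _,_; ∃-syntax; ∃!)
open import Data.Refinement using (Refinement; value)
open import Data.Vec using (Vec; allFin; count; lookup; tabulate; zipWith; _[_]%=_)
open import Function.Bundles using (_↔_; _⇔_; Inverse)
open import Relation.Binary.Core using (Rel)
open import Relation.Binary.Definitions using (Symmetric; Irreflexive)
open import Relation.Binary.PropositionalEquality using (_≡_; _≢_; refl; ≢-sym)
open import Relation.Nullary.Decidable using (¬?)
open import Level using (0ℓ)

record Graph : Set₁ where
  infix 4 _~_
  field
    Vertex : Set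
    _~_    : Rel Vertex 0ℓ
    symm   : Symmetric _~_
    irrefl : Irreflexive _≡_ _~_

-- Membership in P is recorded proof-irrelevantly, so vertices of the
-- induced subgraph are equal as soon as they are equal in G.
induced : (G : Graph) → (Graph.Vertex G → Set) → Graph
induced G P = record
  { Vertex = Refinement Vertex P
  ; _~_    = λ u v → value u ~ value v
  ; symm   = symm
  ; irrefl = λ { refl → irrefl refl }
  }
  where open Graph G

infix 4 _≅_
record _≅_ (G H : Graph) : Set where
  private
    module G = Graph G
    module H = Graph H
  field
    bijection : G.Vertex ↔ H.Vertex
    adjacency : ∀ u v → (u G.~ v) ⇔ (Inverse.to bijection u H.~ Inverse.to bijection v)

Word : ℕ → Set
Word = Vec Bool

-- Truth values: 0 is false, 1 is true.
BoolFun : ℕ → Set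
BoolFun n = Word n → Bool

flipBit : ∀ {n} → Word n → Fin n → Word n
flipBit x i = x [ i ]%= not

sensitivity : ∀ {n} → BoolFun n → Word n → ℕ
sensitivity {n} f x = count (λ i → ¬? (f x ≟ f (flipBit x i))) (allFin n)

Hypercube : ℕ → Graph
Hypercube n = record
  { Vertex = Word n
  ; _~_    = λ x y → ∃! _≡_ λ i → lookup x i ≢ lookup y i
  ; symm   = λ { (i , x≢y , unique) → i , ≢-sym x≢y , λ y≢x → unique (≢-sym y≢x) }
  ; irrefl = λ { refl (_ , x≢x , _) → x≢x refl }
  }

SG : ∀ {n} → ℕ → BoolFun n → Graph
SG {n} K f = induced (Hypercube n) λ x → sensitivity f x ≡ K

SG⁰ : ∀ {n} → ℕ → BoolFun n → Graph
SG⁰ {n} K f = induced (Hypercube n) λ x → sensitivity f x ≡ K × f x ≡ false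

SG¹ : ∀ {n} → ℕ → BoolFun n → Graph
SG¹ {n} K f = induced (Hypercube n) λ x → sensitivity f x ≡ K × f x ≡ true

-- N is the set of coordinates to negate: true xor b = not b, false xor b = b.
negate : ∀ {n} → Subset n → Word n → Word n
negate N x = zipWith _xor_ N x

permute : ∀ {n} → Permutation′ n → Word n → Word n
permute π x = tabulate (λ i → lookup x (π ⟨$⟩ʳ i))

PNEquivalent : ∀ {n} → BoolFun n → BoolFun n → Set
PNEquivalent {n} f g =
  ∃[ π ] ∃[ N ] (∀ (x : Word n) → f (permute π (negate N x)) ≡ g x)

{-# OPTIONS --safe #-}
module Submission where

-- A permutation of the coordinates followed by negations is an automorphism σ
-- of the hypercube which carries the edges at x to the edges at σ x.  Hence if
-- f = g ∘ σ, then σ preserves both the value and the sensitivity, so it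
-- restricts to an isomorphism between the sensitivity graphs of f and of g.

open import Data.Bool using (Bool; false; true; not; if_then_else_; _xor_; _≟_)
open import Data.Bool.Properties using (xor-assoc; xor-same; not-distribʳ-xor)
open import Data.Fin using (Fin; suc)
import Data.Fin as Fin
open import Data.Fin.Permutation
  using (Permutation′; _⟨$⟩ʳ_; _⟨$⟩ˡ_; flip; inverseˡ; inverseʳ)
open import Data.Nat using (ℕ; zero; suc)
open import Data.Nat.Properties using (+-0-commutativeMonoid)
open import Algebra.Properties.CommutativeMonoid.Sum +-0-commutativeMonoid
  using (sum; sum-permute; sum-cong-≗)
open import Data.Product using (_×_; _,_)
open import Data.Refinement using (value)
import Data.Refinement as Refinement
open import Data.Refinement.Properties using (value-injective)
open import Data.Vec using (count; lookup; tabulate)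
open import Data.Vec.Properties
  using (lookup∘tabulate; tabulate∘lookup; tabulate-cong; lookup-zipWith;
         lookup∘updateAt; lookup∘updateAt′)
open import Function using (id; _∘_)
open import Function.Bundles using (mk⇔; mk↔ₛ′; Inverse)
open import Relation.Binary.PropositionalEquality
open import Relation.Nullary using (yes; no; does)
open import Relation.Nullary.Decidable using (¬?)
open import Relation.Unary using (Pred; Decidable)
open import Defs

xor-involutive : ∀ c x → c xor (c xor x) ≡ x
xor-involutive c x = trans (sym (xor-assoc c c x)) (cong (_xor x) (xor-same c))

xor-injective : ∀ c {x y} → c xor x ≡ c xor y → x ≡ y
xor-injective c {x} {y} eq =
  trans (sym (xor-involutive c x)) (trans (cong (c xor_) eq) (xor-involutive c y))

word-ext : ∀ {n} {x y : Word n} → lookup x ≗ lookup y → x ≡ y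
word-ext {x = x} {y} eq =
  trans (sym (tabulate∘lookup x)) (trans (tabulate-cong eq) (tabulate∘lookup y))

-- Turns a count into a sum over `Fin n`, which can be reindexed by a permutation. An arbitrary `h`
-- is needed for the induction, since the tail of `allFin` is no longer an `allFin`.
count-tabulate : ∀ {a p} {A : Set a} {P : Pred A p} (P? : Decidable P) {n}
  (h : Fin n → A) →
  count P? (tabulate h) ≡ sum (λ i → if does (P? (h i)) then 1 else 0)
count-tabulate P? {zero}  h = refl
count-tabulate P? {suc n} h with does (P? (h Fin.zero))
... | true  = cong suc (count-tabulate P? (h ∘ suc))
... | false = count-tabulate P? (h ∘ suc)

induced-≅ : ∀ {G H} (iso : G ≅ H) {P Q} →
  (let to = Inverse.to (_≅_.bijection iso)) →
  (∀ v → P v → Q (to v)) → (∀ v → Q (to v) → P v) →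
  induced G P ≅ induced H Q
induced-≅ iso {P} {Q} P⇒Q Q⇒P = record
  { bijection = mk↔ₛ′
      (Refinement.map to (P⇒Q _))
      -- `Q⇒P` only speaks of words of the form `to v`, so `w` is first rewritten as `to (from w)`.
      (Refinement.map from λ {w} q → Q⇒P (from w) (subst Q (sym (strictlyInverseˡ w)) q))
      (λ w → value-injective (strictlyInverseˡ (value w)))
      (λ v → value-injective (strictlyInverseʳ (value v)))
  ; adjacency = λ u v → adjacency (value u) (value v)
  }
  where
  open _≅_ iso
  open Inverse bijection

-- Signs are indexed by output position, so that the inverse has the same shape, with `flip π` and
-- the signs carried along `π`.
signedPermute : ∀ {n} → Permutation′ n → (Fin n → Bool) → Word n → Word n
signedPermute π ε x = tabulate λ i → ε i xor lookup x (π ⟨$⟩ʳ i)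

module _ {n} (π : Permutation′ n) (ε : Fin n → Bool) where

  lookup-signedPermute : ∀ x i →
    lookup (signedPermute π ε x) i ≡ ε i xor lookup x (π ⟨$⟩ʳ i)
  lookup-signedPermute x = lookup∘tabulate _

  -- Output bit `i` is the only one that reads input bit `π ⟨$⟩ʳ i`, and `not` commutes with xor by
  -- a fixed sign.
  signedPermute-flipBit : ∀ x i →
    signedPermute π ε (flipBit x (π ⟨$⟩ʳ i)) ≡ flipBit (signedPermute π ε x) i
  signedPermute-flipBit x i = word-ext λ j →
    trans (lookup-signedPermute (flipBit x (π ⟨$⟩ʳ i)) j) (at j)
    where
    open ≡-Reasoning
    at : ∀ j → ε j xor lookup (flipBit x (π ⟨$⟩ʳ i)) (π ⟨$⟩ʳ j)
             ≡ lookup (flipBit (signedPermute π ε x) i) j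
    at j with j Fin.≟ i
    ... | yes refl = begin
      ε i xor lookup (flipBit x (π ⟨$⟩ʳ i)) (π ⟨$⟩ʳ i)
        ≡⟨ cong (ε i xor_) (lookup∘updateAt (π ⟨$⟩ʳ i) x) ⟩
      ε i xor not (lookup x (π ⟨$⟩ʳ i))
        ≡⟨ not-distribʳ-xor (ε i) _ ⟨
      not (ε i xor lookup x (π ⟨$⟩ʳ i))
        ≡⟨ cong not (lookup-signedPermute x i) ⟨
      not (lookup (signedPermute π ε x) i)
        ≡⟨ lookup∘updateAt i (signedPermute π ε x) ⟨
      lookup (flipBit (signedPermute π ε x) i) i ∎
    ... | no j≢i = begin
      ε j xor lookup (flipBit x (π ⟨$⟩ʳ i)) (π ⟨$⟩ʳ j)
        ≡⟨ cong (ε j xor_) (lookup∘updateAt′ _ _ (j≢i ∘ π-injective) x) ⟩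
      ε j xor lookup x (π ⟨$⟩ʳ j)
        ≡⟨ lookup-signedPermute x j ⟨
      lookup (signedPermute π ε x) j
        ≡⟨ lookup∘updateAt′ j i j≢i (signedPermute π ε x) ⟨
      lookup (flipBit (signedPermute π ε x) i) j ∎
      where
      π-injective : π ⟨$⟩ʳ j ≡ π ⟨$⟩ʳ i → j ≡ i
      π-injective eq =
        trans (sym (inverseˡ π)) (trans (cong (π ⟨$⟩ˡ_) eq) (inverseˡ π))

  -- The two signs met by each bit are equal and cancel. Keeping `δ` abstract lets this one lemma
  -- give both inverse laws, with `ε` and `δ` exchanged.
  signedPermute-inverse : ∀ δ → (∀ i → δ (π ⟨$⟩ʳ i) ≡ ε i) →
    ∀ x → signedPermute π ε (signedPermute (flip π) δ x) ≡ x
  signedPermute-inverse δ δπ≡ε x = word-ext λ i → begin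
    lookup (signedPermute π ε (signedPermute (flip π) δ x)) i
      ≡⟨ lookup-signedPermute (signedPermute (flip π) δ x) i ⟩
    ε i xor lookup (signedPermute (flip π) δ x) (π ⟨$⟩ʳ i)
      ≡⟨ cong (ε i xor_) (lookup∘tabulate _ (π ⟨$⟩ʳ i)) ⟩
    ε i xor (δ (π ⟨$⟩ʳ i) xor lookup x (π ⟨$⟩ˡ (π ⟨$⟩ʳ i)))
      ≡⟨ cong₂ (λ b j → ε i xor (b xor lookup x j)) (δπ≡ε i) (inverseˡ π) ⟩
    ε i xor (ε i xor lookup x i)
      ≡⟨ xor-involutive (ε i) _ ⟩
    lookup x i ∎
    where open ≡-Reasoning

  -- The differing position `i` moves to `π ⟨$⟩ˡ i`. Outputs that differ at `j` come from inputs
  -- that differ at `π ⟨$⟩ʳ j`, which must then be `i`.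
  signedPermute-adjacent : ∀ x y → (let open Graph (Hypercube n)) →
    x ~ y → signedPermute π ε x ~ signedPermute π ε y
  signedPermute-adjacent x y (i , xᵢ≢yᵢ , unique) =
    π ⟨$⟩ˡ i , σx≢σy , λ {j} neq →
      trans (cong (π ⟨$⟩ˡ_) (unique (neq ∘ agree j))) (inverseˡ π)
    where
    agree : ∀ j → lookup x (π ⟨$⟩ʳ j) ≡ lookup y (π ⟨$⟩ʳ j) →
      lookup (signedPermute π ε x) j ≡ lookup (signedPermute π ε y) j
    agree j eq = trans (lookup-signedPermute x j)
      (trans (cong (ε j xor_) eq) (sym (lookup-signedPermute y j)))

    σx≢σy : lookup (signedPermute π ε x) (π ⟨$⟩ˡ i) ≢ lookup (signedPermute π ε y) (π ⟨$⟩ˡ i)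
    σx≢σy eq = xᵢ≢yᵢ (subst (λ k → lookup x k ≡ lookup y k) (inverseʳ π)
      (xor-injective (ε (π ⟨$⟩ˡ i))
        (trans (sym (lookup-signedPermute x _)) (trans eq (lookup-signedPermute y _)))))

signedPermute-≅ : ∀ {n} → Permutation′ n → (Fin n → Bool) → Hypercube n ≅ Hypercube n
signedPermute-≅ {n} π ε = record
  { bijection = mk↔ₛ′ σ σ⁻¹ σσ⁻¹ σ⁻¹σ
  ; adjacency = λ x y → mk⇔ (signedPermute-adjacent π ε x y) λ σx~σy →
      subst₂ _~_ (σ⁻¹σ x) (σ⁻¹σ y) (signedPermute-adjacent (flip π) δ (σ x) (σ y) σx~σy)
  }
  where
  open Graph (Hypercube n)
  δ : Fin n → Bool
  δ = ε ∘ (π ⟨$⟩ˡ_)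
  σ σ⁻¹ : Word n → Word n
  σ   = signedPermute π ε
  σ⁻¹ = signedPermute (flip π) δ
  σσ⁻¹ : ∀ x → σ (σ⁻¹ x) ≡ x
  σσ⁻¹ = signedPermute-inverse π ε δ λ i → cong ε (inverseˡ π)
  σ⁻¹σ : ∀ x → σ⁻¹ (σ x) ≡ x
  -- `flip (flip π)` acts as `π` by computation, and the sign condition is the definition of `δ`.
  σ⁻¹σ = signedPermute-inverse (flip π) δ ε λ _ → refl

permute-negate : ∀ {n} (π : Permutation′ n) N (x : Word n) →
  permute π (negate N x) ≡ signedPermute π (λ i → lookup N (π ⟨$⟩ʳ i)) x
permute-negate π N x = tabulate-cong λ i → lookup-zipWith _xor_ (π ⟨$⟩ʳ i) N x

differ : Bool → Bool → ℕ
differ b c = if does (¬? (b ≟ c)) then 1 else 0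

sensitivity-sum : ∀ {n} (f : BoolFun n) x →
  sensitivity f x ≡ sum (λ i → differ (f x) (f (flipBit x i)))
sensitivity-sum f x = count-tabulate (λ i → ¬? (f x ≟ f (flipBit x i))) id

-- The neighbour of `σ x` in direction `i` is the image of the neighbour of `x` in direction
-- `π ⟨$⟩ʳ i`, so the two sums have the same terms up to reindexing by `π`.
sensitivity-signedPermute : ∀ {n} (π : Permutation′ n) ε (f g : BoolFun n) →
  (∀ x → g (signedPermute π ε x) ≡ f x) →
  ∀ x → sensitivity g (signedPermute π ε x) ≡ sensitivity f x
sensitivity-signedPermute π ε f g gσ≡f x = begin
  sensitivity g (σ x)
    ≡⟨ sensitivity-sum g (σ x) ⟩
  sum (λ i → differ (g (σ x)) (g (flipBit (σ x) i)))
    ≡⟨ sum-cong-≗ (λ i → cong₂ differ (gσ≡f x) (flipped i)) ⟩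
  sum (λ i → differ (f x) (f (flipBit x (π ⟨$⟩ʳ i))))
    ≡⟨ sum-permute (λ i → differ (f x) (f (flipBit x i))) π ⟨
  sum (λ i → differ (f x) (f (flipBit x i)))
    ≡⟨ sensitivity-sum f x ⟨
  sensitivity f x ∎
  where
  open ≡-Reasoning
  σ = signedPermute π ε
  flipped : ∀ i → g (flipBit (σ x) i) ≡ f (flipBit x (π ⟨$⟩ʳ i))
  flipped i = trans (cong g (sym (signedPermute-flipBit π ε x i))) (gσ≡f _)

mainTheorem3 : ∀ (n : ℕ) (f g : BoolFun n) → PNEquivalent f g →
    ∀ (K : ℕ) → (SG K f ≅ SG K g) × (SG⁰ K f ≅ SG⁰ K g) × (SG¹ K f ≅ SG¹ K g)
mainTheorem3 n f g (π , N , f∘PN≡g) K =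
    induced-≅ iso (λ x → trans (sens x)) (λ x → trans (sym (sens x)))
  , valued , valued
  where
  ε δ : Fin n → Bool
  ε i = lookup N (π ⟨$⟩ʳ i)
  δ j = ε (π ⟨$⟩ˡ j)

  -- The given transformation takes words for `g` to words for `f`; its inverse is the map required
  -- here.
  iso : Hypercube n ≅ Hypercube n
  iso = signedPermute-≅ (flip π) δ

  val : ∀ x → g (signedPermute (flip π) δ x) ≡ f x
  val x = trans (sym (f∘PN≡g _)) (cong f (trans (permute-negate π N _)
    (signedPermute-inverse π ε δ (λ i → cong ε (inverseˡ π)) x)))

  sens : ∀ x → sensitivity g (signedPermute (flip π) δ x) ≡ sensitivity f x
  sens = sensitivity-signedPermute (flip π) δ f g val

  -- With `b` equal to `false` or `true` this unfolds to the statement for `SG⁰` or `SG¹`.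
  valued : ∀ {b} → induced (Hypercube n) (λ x → sensitivity f x ≡ K × f x ≡ b)
                 ≅ induced (Hypercube n) (λ x → sensitivity g x ≡ K × g x ≡ b)
  valued = induced-≅ iso
    (λ x (s , v) → trans (sens x) s , trans (val x) v)
    (λ x (s , v) → trans (sym (sens x)) s , trans (sym (val x)) v)
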